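{- Let $b=(b_0,b_1,b_2,\ldots)$ be an infinite sequence of integers, regarded as a function $b:\mathbb{Z}_{\ge 0}\to\mathbb{Z}$ with $b(x)=b_x$. Assume that (1) $b(0)$ is odd, and (2) $2^{m+1}\mid(\Delta^m b)(x)$ for all integers $m\ge 1$ and all $x\in\mathbb{Z}_{\ge 0}$. Then for every integer $n\ge 0$, $$\xi(C_n^b)=\xi(C_n)=s(n+1)-1.$$
   Context: $\mathbb{Z}_{\ge 0}$ denotes the nonnegative integers. The difference operator $\Delta$ acts on functions $f:\mathbb{Z}_{\ge 0}\to\mathbb{Z}$ by $(\Delta f)(x)=f(x+1)-f(x)$, and $\Delta^m$ is its $m$-fold iterate. $\xi(k)$ denotes the base two exponent of an integer $k$, i.e. the exponent of the largest power of $2$ dividing $k$ (the $2$-adic valuation). $s(k)$ denotes the sum of the digits in the binary expansion of $k$. $C_n=\frac{1}{n+1}\binom{2n}{n}$ is the $n$th Catalan number. A Dyck path $P$ of length $2n$ is a sequence of lattice points $(x_0,y_0)=(0,0),(x_1,y_1),\ldots,(x_{2n},y_{2n})=(2n,0)$ in the upper half-plane (all $y_i\ge 0$) such that each step $[x_i-x_{i-1},y_i-y_{i-1}]$ is $[1,1]$ or $[1,-1]$. The height of the $i$th step is $y_{i-1}$. The weight of $P$ is $\mathrm{wt}(P)=b_{h_1}b_{h_2}\cdots b_{h_n}$, where $h_1,\ldots,h_n$ are the heights of the steps of $P$ of the form $[1,1]$. The weighted Catalan number is $C_n^b=\sum_P \mathrm{wt}(P)$, the sum being over all Dyck paths of length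 $2n$. (Equivalently, the $C_n^b$ are the coefficients in the expansion of the continued fraction $\cfrac{1}{1-\cfrac{b_0x}{1-\cfrac{b_1x}{1-\cfrac{b_2x}{1-\cdots}}}}=\sum_{n\ge 0}C_n^b x^n$.) -}

module Defs where

open import Data.Empty using (⊥)
open import Data.Digit using (toDigits)
open import Data.Fin.Base using (toℕ)
open import Data.Integer.Base as ℤ using (ℤ; +_)
open import Data.Integer.Divisibility using () renaming (_∣_ to _∣ℤ_)
open import Data.List.Base using (List; []; _∷_; _++_; map; foldr)
open import Data.List.Membership.Propositional using (_∈_)
open import Data.List.Membership.Propositional.Properties using (∈-map⁺; ∈-map⁻; ∈-++⁺ˡ; ∈-++⁺ʳ)
open import Data.List.Relation.Unary.All using ([])
open import Data.List.Relation.Unary.AllPairs using ([]; _∷_)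
open import Data.List.Relation.Unary.Any using (here)
open import Data.List.Relation.Unary.Unique.Propositional using (Unique)
open import Data.List.Relation.Unary.Unique.Propositional.Properties using (map⁺; ++⁺)
open import Data.Nat.Base using (ℕ; zero; suc; _*_; _^_; _/_; _≤_)
open import Data.Nat.Combinatorics using (_C_)
open import Data.Nat.GeneralisedArithmetic using (fold)
open import Data.Nat.ListAction using (sum)
open import Data.Nat.Properties using (≤-antisym)
open import Data.Product.Base using (∃; _×_; _,_; proj₁)
open import Relation.Binary.PropositionalEquality.Core using (_≡_; refl)

Δ : (ℕ → ℤ) → (ℕ → ℤ)
Δ f x = f (suc x) ℤ.- f x

Δ^ : ℕ → (ℕ → ℤ) → (ℕ → ℤ)
Δ^ m f = fold f Δ m

-- ξ is a relation rather than a function because ξ(0) is undefined: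
-- ξ⟨ 0 ⟩≡ e holds for no e.
infix 4 ξ⟨_⟩≡_

ξ⟨_⟩≡_ : ℤ → ℕ → Set
ξ⟨ k ⟩≡ e = (+ (2 ^ e) ∣ℤ k) × (∀ j → + (2 ^ j) ∣ℤ k → j ≤ e)

ξ-unique : ∀ k {d e} → ξ⟨ k ⟩≡ d → ξ⟨ k ⟩≡ e → d ≡ e
ξ-unique _ (d∣ , d-max) (e∣ , e-max) = ≤-antisym (e-max _ d∣) (d-max _ e∣)

s : ℕ → ℕ
s k = sum (map toℕ (proj₁ (toDigits 2 k)))

-- The division is exact, since n + 1 divides the central binomial
-- coefficient.
catalan : ℕ → ℕ
catalan n = ((2 * n) C n) / suc n

-- Path h l: lattice paths of l steps [1,1] (up) and [1,-1] (down) that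
-- start at height h, end at height 0 and never go below height 0.
-- A path is determined by its steps, so its points are not stored; all
-- their ordinates occur as indices, whose type ℕ makes them nonnegative.
data Path : ℕ → ℕ → Set where
  done : Path 0 0
  up   : ∀ {h l} → Path (suc h) l → Path h (suc l)
  down : ∀ {h l} → Path h l → Path (suc h) (suc l)

DyckPath : ℕ → Set
DyckPath n = Path 0 (2 * n)

wt : (ℕ → ℤ) → ∀ {h l} → Path h l → ℤ
wt b done       = + 1
wt b (up {h} p) = b h ℤ.* wt b p
wt b (down p)   = wt b p

paths : ∀ h l → List (Path h l)
paths zero    zero    = done ∷ []
paths (suc h) zero    = []
paths zero    (suc l) = map up (paths 1 l)
paths (suc h) (suc l) = map up (paths (suc (suc h)) l) ++ map down (paths h l)

dyckPaths : ∀ n → List (DyckPath n)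
dyckPaths n = paths 0 (2 * n)

weightedCatalan : (ℕ → ℤ) → ℕ → ℤ
weightedCatalan b n = foldr ℤ._+_ (+ 0) (map (wt b) (dyckPaths n))

-- The next two lemmas show that summing over the list dyckPaths n is
-- summing over all Dyck paths of length 2n, each counted once.
paths-complete : ∀ {h l} (p : Path h l) → p ∈ paths h l
paths-complete done                 = here refl
paths-complete {zero}  (up p)       = ∈-map⁺ up (paths-complete p)
paths-complete {suc h} (up p)       = ∈-++⁺ˡ (∈-map⁺ up (paths-complete p))
paths-complete {suc h} {suc l} (down p) =
  ∈-++⁺ʳ (map up (paths (suc (suc h)) l)) (∈-map⁺ down (paths-complete p))

paths-unique : ∀ h l → Unique (paths h l)
paths-unique zero    zero    = [] ∷ []
paths-unique (suc h) zero    = []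
paths-unique zero    (suc l) = map⁺ (λ { refl → refl }) (paths-unique 1 l)
paths-unique (suc h) (suc l) =
  ++⁺ (map⁺ (λ { refl → refl }) (paths-unique (suc (suc h)) l))
      (map⁺ (λ { refl → refl }) (paths-unique h l))
      λ (p∈up , p∈down) → disjoint (∈-map⁻ up p∈up) (∈-map⁻ down p∈down)
  where
  disjoint : {p : Path (suc h) (suc l)} {us : List (Path (suc (suc h)) l)} {ds : List (Path h l)} →
             (∃ λ u → u ∈ us × p ≡ up u) → (∃ λ d → d ∈ ds × p ≡ down d) → ⊥
  disjoint (_ , _ , refl) (_ , _ , ())

{-# OPTIONS --safe #-}

-- Let F n (x) be the weighted Catalan number of the shifted sequence
-- b(x), b(x+1), …, and p(n) = s(n+1) − 1. Splitting a Dyck path at its first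
-- return gives F (n+1) (x) = b(x) Σ_{i+j=n} F i (x+1) F j (x). By induction
-- F n = 2^p(n) u, where u, like b, is odd with 2^(m+1) ∣ Δ^m u for m ≥ 1: the
-- terms for (i, j) and (j, i) together gain an extra factor 2, and
-- p(n+1) ≤ p(i) + p(j) + 1 by subadditivity of s, so that modulo the admissible
-- errors each F i may be replaced by the constant 2^p(i). What remains is
-- Σ_{i+j=n} 2^(p(i)+p(j)) ≡ 2^p(n+1) modulo 2^(p(n+1)+1), which follows from the
-- product formula Σ 2^s(n) zⁿ = Π (1 + 2 z^(2^k)). For the ordinary Catalan
-- numbers the valuation comes from Legendre's formula for n!.

module Submission where

open import Defs
open import Data.Digit using (Digit; Expansion; fromDigits; toDigits)
open import Data.Fin.Base as Fin using (toℕ)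
open import Data.Integer.Base using (ℤ; +_; 0ℤ; 1ℤ) renaming (_+_ to _+ᶻ_; _-_ to _-ᶻ_; _*_ to _*ᶻ_)
open import Data.Integer.Divisibility using (_∣_)
open import Data.Integer.Divisibility.Signed using (divides; ∣ᵤ⇒∣; ∣⇒∣ᵤ; ∣-refl; ∣-trans; ∣m∣n⇒∣m+n; ∣m∣n⇒∣m-n) renaming (_∣_ to _∣ˢ_)
open import Data.Integer.DivMod using (a≡a%n+[a/n]*n; n%d<d) renaming (_%_ to _%ᶻ_; _/_ to _/ᶻ_)
import Data.Integer.Properties as ℤ
open import Data.Integer.Tactic.RingSolver using (solve-∀)
open import Data.List.Base using (List; []; _∷_; _++_; foldr; map)
open import Data.List.Properties using (map-++)
open import Data.Nat.Base
open import Data.Nat.Combinatorics using (_C_; nCk≡n!/k![n-k]!; k![n∸k]!∣n!)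
open import Data.Nat.Coprimality using (Coprime; coprime-divisor)
open import Data.Nat.Divisibility using (∣m+n∣m⇒∣n; ∣n⇒∣m*n; ∣1⇒≡1; ∣⇒≤) renaming (_∣_ to _∣ℕ_; divides to dividesℕ)
open import Data.Nat.DivMod using (_divMod_; result; m/n*n≡m)
open import Data.Nat.Induction using (<-rec)
open import Data.Nat.ListAction using (sum)
open import Data.Nat.Properties
open import Data.Nat.Tactic.RingSolver renaming (solve-∀ to solve-∀ℕ) using ()
open import Data.Product.Base using (∃; ∃₂; _×_; _,_; proj₁; proj₂)
open import Data.Sum.Base using (_⊎_; inj₁; inj₂)
open import Data.Unit.Base using (⊤; tt)
open import Function.Base using (_∘_)
open import Relation.Nullary.Negation.Core using (¬_; contradiction)
open import Relation.Binary.PropositionalEquality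

-- Binary digit sums

digitSum : Expansion 2 → ℕ
digitSum ds = sum (map toℕ ds)

halve : ∀ n → ∃ λ k → n ≡ k * 2 ⊎ n ≡ 1 + k * 2
halve n with n divMod 2
... | result k Fin.zero           eq = k , inj₁ eq
... | result k (Fin.suc Fin.zero) eq = k , inj₂ eq

double≢odd : ∀ m n → m * 2 ≢ 1 + n * 2
double≢odd m n eq = even≢odd m n
  (trans (*-comm 2 m) (trans eq (cong suc (*-comm n 2))))

digitSum-zero : ∀ ds → fromDigits ds ≡ 0 → digitSum ds ≡ 0
digitSum-zero []              _  = refl
digitSum-zero (Fin.zero ∷ ds) eq =
  digitSum-zero ds (m*n≡0⇒m≡0 (fromDigits ds) 2 eq)

-- The parity of the value fixes the lowest digit, and cancelling 2 passes to the tails; a surplus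
-- of high zeros adds nothing. Hence only the correctness of `toDigits` matters below, never how it
-- computes.
digitSum-unique : ∀ ds ds′ → fromDigits ds ≡ fromDigits ds′ → digitSum ds ≡ digitSum ds′
digitSum-unique [] ds′ eq = sym (digitSum-zero ds′ (sym eq))
digitSum-unique ds@(_ ∷ _) [] eq = digitSum-zero ds eq
digitSum-unique (Fin.zero ∷ ds) (Fin.zero ∷ ds′) eq =
  digitSum-unique ds ds′ (*-cancelʳ-≡ _ _ 2 eq)
digitSum-unique (Fin.suc Fin.zero ∷ ds) (Fin.suc Fin.zero ∷ ds′) eq =
  cong suc (digitSum-unique ds ds′ (*-cancelʳ-≡ _ _ 2 (suc-injective eq)))
digitSum-unique (Fin.zero ∷ ds) (Fin.suc Fin.zero ∷ ds′) eq =
  contradiction eq (double≢odd (fromDigits ds) (fromDigits ds′))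
digitSum-unique (Fin.suc Fin.zero ∷ ds) (Fin.zero ∷ ds′) eq =
  contradiction (sym eq) (double≢odd (fromDigits ds′) (fromDigits ds))

s-digit : ∀ (d : Digit 2) k → s (toℕ d + k * 2) ≡ toℕ d + s k
s-digit d k = digitSum-unique (proj₁ (toDigits 2 (toℕ d + k * 2))) (d ∷ proj₁ (toDigits 2 k))
  (trans (proj₂ (toDigits 2 (toℕ d + k * 2)))
         (cong (λ i → toℕ d + i * 2) (sym (proj₂ (toDigits 2 k)))))

s-even : ∀ k → s (k * 2) ≡ s k
s-even = s-digit Fin.zero

s-odd : ∀ k → s (1 + k * 2) ≡ 1 + s k
s-odd = s-digit (Fin.suc Fin.zero)

Odd : ℕ → Set
Odd n = ∃ λ k → n ≡ 1 + k * 2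

odd-* : ∀ {m n} → Odd m → Odd n → Odd (m * n)
odd-* (i , refl) (j , refl) = i + j + i * j * 2 , lemma i j
  where
  lemma : ∀ i j → (1 + i * 2) * (1 + j * 2) ≡ 1 + (i + j + i * j * 2) * 2
  lemma = solve-∀ℕ

-- The number v of factors 2 in n + 1 is the number of carries in the
-- binary addition n + 1.
s-suc : ∀ n → ∃₂ λ v q → Odd q × suc n ≡ 2 ^ v * q × s (suc n) + v ≡ suc (s n)
s-suc = <-rec _ step
  where
  step : ∀ n → (∀ {m} → m < n → ∃₂ λ v q → Odd q × suc m ≡ 2 ^ v * q × s (suc m) + v ≡ suc (s m)) →
         ∃₂ λ v q → Odd q × suc n ≡ 2 ^ v * q × s (suc n) + v ≡ suc (s n)
  step n rec with halve n
  ... | k , inj₁ refl = 0 , suc n , (k , refl) , sym (+-identityʳ (suc n)) ,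
    trans (+-identityʳ _) (trans (s-odd k) (cong suc (sym (s-even k))))
  ... | k , inj₂ refl with rec (s≤s (m≤m*n k 2))
  ...   | v , q , odd-q , eq , eq-s = suc v , q , odd-q ,
    trans (*-comm (suc k) 2) (trans (cong (2 *_) eq) (sym (*-assoc 2 (2 ^ v) q))) ,
    (begin
      s (suc k * 2) + suc v ≡⟨ cong (_+ suc v) (s-even (suc k)) ⟩
      s (suc k) + suc v     ≡⟨ +-suc _ v ⟩
      suc (s (suc k) + v)   ≡⟨ cong suc eq-s ⟩
      suc (suc (s k))       ≡⟨ cong suc (s-odd k) ⟨
      suc (s (suc (k * 2))) ∎)
    where open ≡-Reasoning

s-suc-≤ : ∀ n → s (suc n) ≤ suc (s n)
s-suc-≤ n with s-suc n
... | v , _ , _ , _ , eq = ≤-trans (m≤m+n _ v) (≤-reflexive eq)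

-- Ensures that the truncated subtraction in `p` is exact.
s-pos : ∀ n → 1 ≤ s (suc n)
s-pos = <-rec _ step
  where
  step : ∀ n → (∀ {m} → m < n → 1 ≤ s (suc m)) → 1 ≤ s (suc n)
  step n rec with halve n
  ... | k , inj₁ refl = subst (1 ≤_) (sym (s-odd k)) (s≤s z≤n)
  ... | k , inj₂ refl = subst (1 ≤_) (sym (s-even (suc k))) (rec (s≤s (m≤m*n k 2)))

s-subadditive : ∀ m n → s (m + n) ≤ s m + s n
s-subadditive = <-rec _ step
  where
  step : ∀ m → (∀ {k} → k < m → ∀ n → s (k + n) ≤ s k + s n) → ∀ n → s (m + n) ≤ s m + s n
  step zero    _   n = m≤n+m (s n) (s 0)
  step m@(suc m-1) rec n with halve m | halve n
  -- As m is positive, an even m has a positive half, which is strictly smaller than m.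
  ... | suc i , inj₁ refl | j , inj₁ refl = begin
    s (suc i * 2 + j * 2)           ≡⟨ cong s (*-distribʳ-+ 2 (suc i) j) ⟨
    s ((suc i + j) * 2)             ≡⟨ s-even (suc i + j) ⟩
    s (suc i + j)                   ≤⟨ rec (s≤s (s≤s (m≤m*n i 2))) j ⟩
    s (suc i) + s j                 ≡⟨ cong₂ _+_ (s-even (suc i)) (s-even j) ⟨
    s (suc i * 2) + s (j * 2)       ∎
    where open ≤-Reasoning
  ... | suc i , inj₁ refl | j , inj₂ refl = begin
    s (suc i * 2 + (1 + j * 2))     ≡⟨ cong s (lemma (suc i) j) ⟩
    s (1 + (suc i + j) * 2)         ≡⟨ s-odd (suc i + j) ⟩
    suc (s (suc i + j))             ≤⟨ s≤s (rec (s≤s (s≤s (m≤m*n i 2))) j) ⟩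
    suc (s (suc i) + s j)           ≡⟨ +-suc _ (s j) ⟨
    s (suc i) + suc (s j)           ≡⟨ cong₂ _+_ (s-even (suc i)) (s-odd j) ⟨
    s (suc i * 2) + s (1 + j * 2)   ∎
    where
    open ≤-Reasoning
    lemma : ∀ i j → i * 2 + (1 + j * 2) ≡ 1 + (i + j) * 2
    lemma = solve-∀ℕ
  ... | i , inj₂ refl | j , inj₁ refl = begin
    s (1 + i * 2 + j * 2)           ≡⟨ cong (λ k → s (suc k)) (*-distribʳ-+ 2 i j) ⟨
    s (1 + (i + j) * 2)             ≡⟨ s-odd (i + j) ⟩
    suc (s (i + j))                 ≤⟨ s≤s (rec (s≤s (m≤m*n i 2)) j) ⟩
    suc (s i + s j)                 ≡⟨ cong₂ _+_ (s-odd i) (s-even j) ⟨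
    s (1 + i * 2) + s (j * 2)       ∎
    where open ≤-Reasoning
  ... | i , inj₂ refl | j , inj₂ refl = begin
    s (1 + i * 2 + (1 + j * 2))     ≡⟨ cong s (lemma i j) ⟩
    s (suc (i + j) * 2)             ≡⟨ s-even (suc (i + j)) ⟩
    -- Two odd numbers produce a carry. It raises the digit sum of the half by at most 1, whereas
    -- the two lowest digits contribute 2.
    s (suc (i + j))                 ≤⟨ s-suc-≤ (i + j) ⟩
    suc (s (i + j))                 ≤⟨ s≤s (rec (s≤s (m≤m*n i 2)) j) ⟩
    suc (s i + s j)                 ≤⟨ s≤s (+-monoʳ-≤ (s i) (n≤1+n (s j))) ⟩
    suc (s i) + suc (s j)           ≡⟨ cong₂ _+_ (s-odd i) (s-odd j) ⟨
    s (1 + i * 2) + s (1 + j * 2)   ∎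
    where
    open ≤-Reasoning
    lemma : ∀ i j → 1 + i * 2 + (1 + j * 2) ≡ suc (i + j) * 2
    lemma = solve-∀ℕ

p : ℕ → ℕ
p n = s (suc n) ∸ 1

s≡suc-p : ∀ n → s (suc n) ≡ suc (p n)
s≡suc-p n = sym (m+[n∸m]≡n (s-pos n))

-- Catalan numbers

-- Legendre's formula, with n - s(n) factors 2 in n!, written multiplicatively to avoid the
-- subtraction. The factor n + 1 brings v further twos, and `s-suc` relates v to the change of the
-- digit sum.
legendre : ∀ n → ∃ λ q → Odd q × 2 ^ s n * n ! ≡ 2 ^ n * q
legendre zero = 1 , (0 , refl) , refl
legendre (suc n) with legendre n | s-suc n
... | q , odd-q , eq | v , r , odd-r , n≡ , s≡ = q * r , odd-* odd-q odd-r , (begin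
  2 ^ s (suc n) * (suc n * n !)          ≡⟨ cong (λ k → 2 ^ s (suc n) * (k * n !)) n≡ ⟩
  2 ^ s (suc n) * (2 ^ v * r * n !)      ≡⟨ lemma (2 ^ s (suc n)) (2 ^ v) r (n !) ⟩
  2 ^ s (suc n) * 2 ^ v * n ! * r        ≡⟨ cong (λ k → k * n ! * r) (^-distribˡ-+-* 2 (s (suc n)) v) ⟨
  2 ^ (s (suc n) + v) * n ! * r          ≡⟨ cong (λ k → 2 ^ k * n ! * r) s≡ ⟩
  2 * 2 ^ s n * n ! * r                  ≡⟨ cong (_* r) (*-assoc 2 (2 ^ s n) (n !)) ⟩
  2 * (2 ^ s n * n !) * r                ≡⟨ cong (λ k → 2 * k * r) eq ⟩
  2 * (2 ^ n * q) * r                    ≡⟨ lemma′ (2 ^ n) q r ⟩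
  2 * 2 ^ n * (q * r)                    ∎)
  where
  open ≡-Reasoning
  lemma : ∀ a b r f → a * (b * r * f) ≡ a * b * f * r
  lemma = solve-∀ℕ
  lemma′ : ∀ a q r → 2 * (a * q) * r ≡ 2 * a * (q * r)
  lemma′ = solve-∀ℕ

-- An odd m contributes no factor 2, so all e of them lie in n; they are cancelled one at a time by
-- comparing parities.
odd-factor : ∀ e {m n q} → Odd m → Odd q → m * n ≡ 2 ^ e * q → ∃ λ r → Odd r × n ≡ 2 ^ e * r
odd-factor zero {m} {n} {q} _ (j , refl) eq with halve n
... | k , inj₁ refl = contradiction (trans (*-assoc m k 2) (trans eq (*-identityˡ q))) (double≢odd (m * k) j)
... | k , inj₂ refl = n , (k , refl) , sym (*-identityˡ n)
odd-factor (suc e) {m} {n} {q} odd-m odd-q eq with halve n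
... | k , inj₂ refl = contradiction
  (trans (*-comm (2 ^ e * q) 2) (trans (sym (*-assoc 2 (2 ^ e) q))
    (trans (sym eq) (proj₂ odd-mn))))
  (double≢odd (2 ^ e * q) (proj₁ odd-mn))
  where odd-mn = odd-* odd-m (k , refl)
... | k , inj₁ refl with odd-factor e odd-m odd-q
                           (*-cancelʳ-≡ (m * k) (2 ^ e * q) 2
                             (trans (*-assoc m k 2) (trans eq (lemma (2 ^ e) q))))
  where
  lemma : ∀ a q → 2 * a * q ≡ a * q * 2
  lemma = solve-∀ℕ
...   | r , odd-r , refl = r , odd-r , lemma (2 ^ e) r
  where
  lemma : ∀ a r → a * r * 2 ≡ 2 * a * r
  lemma = solve-∀ℕ

nCk*k!*m!≡n! : ∀ k m → ((k + m) C k) * (k ! * m !) ≡ (k + m) !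
nCk*k!*m!≡n! k m = begin
  ((k + m) C k) * (k ! * m !)                              ≡⟨ cong (λ i → ((k + m) C k) * (k ! * i !)) (m+n∸m≡n k m) ⟨
  ((k + m) C k) * (k ! * (k + m ∸ k) !)                    ≡⟨ cong (_* (k ! * (k + m ∸ k) !)) (nCk≡n!/k![n-k]! k≤k+m) ⟩
  (k + m) ! / (k ! * (k + m ∸ k) !) * (k ! * (k + m ∸ k) !) ≡⟨ m/n*n≡m (k![n∸k]!∣n! k≤k+m) ⟩
  (k + m) !                                                ∎
  where
  open ≡-Reasoning
  k≤k+m = m≤m+n k m
  instance _ = k !* (k + m ∸ k) !≢0

central : ℕ → ℕ
central n = (2 * n) C n

central*n!*n!≡2n! : ∀ n → central n * (n ! * n !) ≡ (2 * n) !
central*n!*n!≡2n! n = subst (λ m → (m C n) * (n ! * n !) ≡ m !)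
  (cong (λ k → n + k) (sym (+-identityʳ n))) (nCk*k!*m!≡n! n n)

-- The product of 2n + 1 and the central coefficient is (n + 1) times the binomial coefficient of 2n
-- + 1 over n + 1, and n + 1 is coprime to 2n + 1 because 2(n + 1) = (2n + 1) + 1.
suc-n∣central : ∀ n → suc n ∣ℕ central n
suc-n∣central n = coprime-divisor coprime
  (dividesℕ (suc (2 * n) C suc n) (*-cancelʳ-≡ _ _ (n ! * n !) (begin
    suc (2 * n) * central n * (n ! * n !)        ≡⟨ *-assoc (suc (2 * n)) (central n) (n ! * n !) ⟩
    suc (2 * n) * (central n * (n ! * n !))      ≡⟨ cong (suc (2 * n) *_) (central*n!*n!≡2n! n) ⟩
    (suc (2 * n)) !                              ≡⟨ cong (λ m → suc m !) 2n≡n+n ⟩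
    (suc n + n) !                                ≡⟨ nCk*k!*m!≡n! (suc n) n ⟨
    ((suc n + n) C suc n) * (suc n * n ! * n !)  ≡⟨ cong (λ m → (suc m C suc n) * (suc n * n ! * n !)) 2n≡n+n ⟨
    (suc (2 * n) C suc n) * (suc n * n ! * n !)  ≡⟨ lemma (suc (2 * n) C suc n) (suc n) (n !) ⟩
    (suc (2 * n) C suc n) * suc n * (n ! * n !)  ∎)))
  where
  open ≡-Reasoning
  instance _ = n !* n !≢0
  2n≡n+n : 2 * n ≡ n + n
  2n≡n+n = cong (λ k → n + k) (+-identityʳ n)
  lemma : ∀ c a f → c * (a * f * f) ≡ c * a * (f * f)
  lemma = solve-∀ℕ
  coprime : Coprime (suc n) (suc (2 * n))
  coprime {d} (d∣1+n , d∣1+2n) = ∣1⇒≡1 (∣m+n∣m⇒∣n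
    (subst (d ∣ℕ_) (lemma′ n) (∣n⇒∣m*n 2 d∣1+n)) d∣1+2n)
    where
    lemma′ : ∀ n → 2 * suc n ≡ suc (2 * n) + 1
    lemma′ = solve-∀ℕ

suc-n*catalan≡central : ∀ n → suc n * catalan n ≡ central n
suc-n*catalan≡central n = trans (*-comm (suc n) _) (m/n*n≡m (suc-n∣central n))

-- Since s(2n) = s(n), Legendre's formula for n and 2n gives the central coefficient exactly s(n)
-- factors 2. Dividing by n + 1 removes v of them, and s(n) - v = p(n) by `s-suc`. Everything is
-- cleared of denominators, which leaves the odd cofactor `q * q * t`.
catalan-2adic : ∀ n → ∃ λ q → Odd q × catalan n ≡ 2 ^ p n * q
catalan-2adic n with legendre n | legendre (2 * n) | s-suc n
... | q , odd-q , q≡ | r , odd-r , r≡ | v , t , odd-t , n≡ , s≡ =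
  odd-factor (p n) (odd-* (odd-* odd-q odd-q) odd-t) odd-r
    (*-cancelˡ-≡ _ _ (2 ^ (2 * n) * 2 ^ v) (begin
      2 ^ (2 * n) * 2 ^ v * (q * q * t * catalan n)
        ≡⟨ cong (λ a → a * 2 ^ v * (q * q * t * catalan n)) (trans (cong (2 ^_) 2n≡n+n) (^-distribˡ-+-* 2 n n)) ⟩
      2 ^ n * 2 ^ n * 2 ^ v * (q * q * t * catalan n)
        ≡⟨ lemma₁ (2 ^ n) (2 ^ v) q t (catalan n) ⟩
      2 ^ n * q * (2 ^ n * q) * (2 ^ v * t * catalan n)
        ≡⟨ cong₂ (λ a b → a * a * (b * catalan n)) q≡ n≡ ⟨
      2 ^ s n * n ! * (2 ^ s n * n !) * (suc n * catalan n)
        ≡⟨ cong (2 ^ s n * n ! * (2 ^ s n * n !) *_) (suc-n*catalan≡central n) ⟩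
      2 ^ s n * n ! * (2 ^ s n * n !) * central n
        ≡⟨ lemma₂ (2 ^ s n) (n !) (central n) ⟩
      2 ^ s n * (2 ^ s n * (central n * (n ! * n !)))
        ≡⟨ cong₂ (λ a b → 2 ^ s n * (2 ^ a * b)) (sym s2n≡sn) (central*n!*n!≡2n! n) ⟩
      2 ^ s n * (2 ^ s (2 * n) * (2 * n) !)
        ≡⟨ cong₂ (λ a b → 2 ^ a * b) sn≡v+p r≡ ⟩
      2 ^ (v + p n) * (2 ^ (2 * n) * r)
        ≡⟨ cong (_* (2 ^ (2 * n) * r)) (^-distribˡ-+-* 2 v (p n)) ⟩
      2 ^ v * 2 ^ p n * (2 ^ (2 * n) * r)
        ≡⟨ lemma₃ (2 ^ v) (2 ^ p n) (2 ^ (2 * n)) r ⟩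
      2 ^ (2 * n) * 2 ^ v * (2 ^ p n * r) ∎))
  where
  open ≡-Reasoning
  instance
    _ = m^n≢0 2 (2 * n)
    _ = m^n≢0 2 v
    _ = m*n≢0 (2 ^ (2 * n)) (2 ^ v)
  2n≡n+n : 2 * n ≡ n + n
  2n≡n+n = cong (λ k → n + k) (+-identityʳ n)
  s2n≡sn : s (2 * n) ≡ s n
  s2n≡sn = trans (cong s (*-comm 2 n)) (s-even n)
  sn≡v+p : s n ≡ v + p n
  sn≡v+p = suc-injective (trans (sym s≡) (trans (cong (_+ v) (s≡suc-p n)) (cong suc (+-comm (p n) v))))
  lemma₁ : ∀ a b q t c → a * a * b * (q * q * t * c) ≡ a * q * (a * q) * (b * t * c)
  lemma₁ = solve-∀ℕ
  lemma₂ : ∀ a f c → a * f * (a * f) * c ≡ a * (a * (c * (f * f)))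
  lemma₂ = solve-∀ℕ
  lemma₃ : ∀ b c a r → b * c * (a * r) ≡ a * b * (c * r)
  lemma₃ = solve-∀ℕ

-- Powers of two as integers

2^ : ℕ → ℤ
2^ k = + (2 ^ k)

2^-+ : ∀ j k → 2^ (j + k) ≡ 2^ j *ᶻ 2^ k
2^-+ j k = trans (cong +_ (^-distribˡ-+-* 2 j k)) (ℤ.pos-* (2 ^ j) (2 ^ k))

2^-mono-∣ : ∀ {j k} → j ≤ k → 2^ j ∣ˢ 2^ k
2^-mono-∣ {j} {k} j≤k = divides (2^ (k ∸ j))
  (trans (cong 2^ (sym (m∸n+n≡m j≤k))) (2^-+ (k ∸ j) j))

*-pres-∣ : ∀ {i j m n} → i ∣ˢ m → j ∣ˢ n → i *ᶻ j ∣ˢ m *ᶻ n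
*-pres-∣ {i} {j} (divides k refl) (divides l refl) = divides (k *ᶻ l) (lemma k i l j)
  where
  lemma : ∀ k i l j → k *ᶻ i *ᶻ (l *ᶻ j) ≡ k *ᶻ l *ᶻ (i *ᶻ j)
  lemma = solve-∀

-- Convolution

-- Summation over i + j = n; giving `g` both indices avoids the subtraction n - i.
conv : (ℕ → ℕ → ℤ) → ℕ → ℤ
conv g zero    = g 0 0
conv g (suc n) = g 0 (suc n) +ᶻ conv (λ i j → g (suc i) j) n

conv-cong : ∀ n {g h} → (∀ i j → i + j ≡ n → g i j ≡ h i j) → conv g n ≡ conv h n
conv-cong zero    eq = eq 0 0 refl
conv-cong (suc n) eq = cong₂ _+ᶻ_ (eq 0 (suc n) refl)
  (conv-cong n λ i j i+j≡n → eq (suc i) j (cong suc i+j≡n))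

conv-+ : ∀ n g h → conv (λ i j → g i j +ᶻ h i j) n ≡ conv g n +ᶻ conv h n
conv-+ zero    g h = refl
conv-+ (suc n) g h = trans (cong (g 0 (suc n) +ᶻ h 0 (suc n) +ᶻ_) (conv-+ n _ _))
  (lemma (g 0 (suc n)) (h 0 (suc n)) _ _)
  where
  lemma : ∀ a b c d → a +ᶻ b +ᶻ (c +ᶻ d) ≡ a +ᶻ c +ᶻ (b +ᶻ d)
  lemma = solve-∀

conv-*ˡ : ∀ n a g → conv (λ i j → a *ᶻ g i j) n ≡ a *ᶻ conv g n
conv-*ˡ zero    a g = refl
conv-*ˡ (suc n) a g = trans (cong (a *ᶻ g 0 (suc n) +ᶻ_) (conv-*ˡ n a _))
  (sym (ℤ.*-distribˡ-+ a _ _))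

conv-last : ∀ n g → conv g (suc n) ≡ conv (λ i j → g i (suc j)) n +ᶻ g (suc n) 0
conv-last zero    g = refl
conv-last (suc n) g = trans (cong (g 0 (2 + n) +ᶻ_) (conv-last n (g ∘ suc)))
  (sym (ℤ.+-assoc (g 0 (2 + n)) _ _))

-- Indices with an even sum have equal parity: either both are even, or both are odd and their
-- halves sum to one less.
conv-even : ∀ n g → conv g (suc n * 2) ≡
  conv (λ i j → g (i * 2) (j * 2)) (suc n) +ᶻ conv (λ i j → g (1 + i * 2) (1 + j * 2)) n
conv-even zero    g = lemma (g 0 2) (g 1 1) (g 2 0)
  where
  lemma : ∀ a b c → a +ᶻ (b +ᶻ c) ≡ a +ᶻ c +ᶻ b
  lemma = solve-∀
conv-even (suc n) g = trans
  (cong (λ c → g 0 (suc (suc n) * 2) +ᶻ (g 1 (1 + suc n * 2) +ᶻ c)) (conv-even n λ i → g (2 + i)))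
  (lemma (g 0 (suc (suc n) * 2)) (g 1 (1 + suc n * 2)) _ (conv (λ i j → g (1 + suc i * 2) (1 + j * 2)) n))
  where
  lemma : ∀ a b c d → a +ᶻ (b +ᶻ (c +ᶻ d)) ≡ a +ᶻ c +ᶻ (b +ᶻ d)
  lemma = solve-∀

conv-odd : ∀ n g → conv g (1 + n * 2) ≡
  conv (λ i j → g (i * 2) (1 + j * 2) +ᶻ g (1 + i * 2) (j * 2)) n
conv-odd zero    g = refl
conv-odd (suc n) g = trans
  (cong (λ c → g 0 (1 + suc n * 2) +ᶻ (g 1 (suc n * 2) +ᶻ c)) (conv-odd n λ i → g (2 + i)))
  (sym (ℤ.+-assoc (g 0 (1 + suc n * 2)) _ _))

infixl 7 _⊛_

_⊛_ : (ℕ → ℤ) → (ℕ → ℤ) → ℕ → ℤ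
(f ⊛ g) n = conv (λ i j → f i *ᶻ g j) n

⊛-assoc : ∀ n f g h → (f ⊛ g ⊛ h) n ≡ (f ⊛ (g ⊛ h)) n
⊛-assoc zero    f g h = ℤ.*-assoc (f 0) (g 0) (h 0)
⊛-assoc (suc n) f g h = begin
  f 0 *ᶻ g 0 *ᶻ h (suc n) +ᶻ ((λ i → f 0 *ᶻ g (suc i) +ᶻ (f ∘ suc ⊛ g) i) ⊛ h) n
    ≡⟨ cong (f 0 *ᶻ g 0 *ᶻ h (suc n) +ᶻ_) (conv-cong n λ i j _ →
         trans (ℤ.*-distribʳ-+ (h j) (f 0 *ᶻ g (suc i)) _)
               (cong (_+ᶻ (f ∘ suc ⊛ g) i *ᶻ h j) (ℤ.*-assoc (f 0) (g (suc i)) (h j)))) ⟩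
  f 0 *ᶻ g 0 *ᶻ h (suc n) +ᶻ
    conv (λ i j → f 0 *ᶻ (g (suc i) *ᶻ h j) +ᶻ (f ∘ suc ⊛ g) i *ᶻ h j) n
    ≡⟨ cong (f 0 *ᶻ g 0 *ᶻ h (suc n) +ᶻ_) (trans (conv-+ n _ _)
         (cong₂ _+ᶻ_ (conv-*ˡ n (f 0) _) (⊛-assoc n (f ∘ suc) g h))) ⟩
  f 0 *ᶻ g 0 *ᶻ h (suc n) +ᶻ (f 0 *ᶻ (g ∘ suc ⊛ h) n +ᶻ (f ∘ suc ⊛ (g ⊛ h)) n)
    ≡⟨ lemma (f 0) (g 0) (h (suc n)) _ _ ⟩
  f 0 *ᶻ (g 0 *ᶻ h (suc n) +ᶻ (g ∘ suc ⊛ h) n) +ᶻ (f ∘ suc ⊛ (g ⊛ h)) n ∎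
  where
  open ≡-Reasoning
  lemma : ∀ a b c d e → a *ᶻ b *ᶻ c +ᶻ (a *ᶻ d +ᶻ e) ≡ a *ᶻ (b *ᶻ c +ᶻ d) +ᶻ e
  lemma = solve-∀

-- The convolution square of 2^s(n)

E V : ℕ → ℤ
E k = 2^ (s k)
V = E ⊛ E

E-even : ∀ k → E (k * 2) ≡ E k
E-even k = cong 2^ (s-even k)

E-odd : ∀ k → E (1 + k * 2) ≡ + 2 *ᶻ E k
E-odd k = trans (cong 2^ (s-odd k)) (2^-+ 1 (s k))

-- E(z) = (1 + 2z) E(z²), hence V(z) = (1 + 4z²) V(z²) + 4z V(z²).
V-even : ∀ n → V (suc n * 2) ≡ V (suc n) +ᶻ + 4 *ᶻ V n
V-even n = trans (conv-even n λ i j → E i *ᶻ E j) (cong₂ _+ᶻ_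
  (conv-cong (suc n) λ i j _ → cong₂ _*ᶻ_ (E-even i) (E-even j))
  (trans (conv-cong n λ i j _ → trans (cong₂ _*ᶻ_ (E-odd i) (E-odd j)) (lemma (E i) (E j)))
         (conv-*ˡ n (+ 4) _)))
  where
  lemma : ∀ a b → + 2 *ᶻ a *ᶻ (+ 2 *ᶻ b) ≡ + 4 *ᶻ (a *ᶻ b)
  lemma = solve-∀

V-odd : ∀ n → V (1 + n * 2) ≡ + 4 *ᶻ V n
V-odd n = trans (conv-odd n λ i j → E i *ᶻ E j) (trans
  (conv-cong n λ i j _ → trans
    (cong₂ _+ᶻ_ (cong₂ _*ᶻ_ (E-even i) (E-odd j)) (cong₂ _*ᶻ_ (E-odd i) (E-even j)))
    (lemma (E i) (E j)))
  (conv-*ˡ n (+ 4) _))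
  where
  lemma : ∀ a b → a *ᶻ (+ 2 *ᶻ b) +ᶻ + 2 *ᶻ a *ᶻ b ≡ + 4 *ᶻ (a *ᶻ b)
  lemma = solve-∀

-- Induction along `V-even` and `V-odd`. The index starts at 2 because the bound fails at 1: `V 1`
-- is 4, but 8 would be required.
V-divisible : ∀ n → 2^ (2 + s (2 + n)) ∣ˢ V (2 + n)
V-divisible = <-rec _ step
  where
  -- The second term of `V-even` carries a factor 4 already, so this weaker bound suffices for it,
  -- and it does hold at index 1.
  previous : ∀ k → (∀ {m} → m < k → 2^ (2 + s (2 + m)) ∣ˢ V (2 + m)) → 2^ (s (2 + k)) ∣ˢ V (1 + k)
  previous zero    _   = divides (+ 2) refl
  previous (suc k) rec = ∣-trans (2^-mono-∣ (m≤n⇒m≤1+n (s-suc-≤ (2 + k)))) (rec ≤-refl)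
  step : ∀ n → (∀ {m} → m < n → 2^ (2 + s (2 + m)) ∣ˢ V (2 + m)) → 2^ (2 + s (2 + n)) ∣ˢ V (2 + n)
  step n rec with halve n
  -- The base values `V 2` = 8 and `V 3` = 16 equal the required powers.
  ... | zero , inj₁ refl = ∣-refl
  ... | zero , inj₂ refl = ∣-refl
  ... | suc k , inj₁ refl = subst (2^ (2 + s (2 + suc k * 2)) ∣ˢ_) (sym (V-even (suc k)))
    (∣m∣n⇒∣m+n
      (subst (λ e → 2^ (2 + e) ∣ˢ V (2 + k)) (sym (s-even (2 + k))) (rec k<n))
      (subst (_∣ˢ + 4 *ᶻ V (suc k))
             (sym (trans (cong (λ e → 2^ (2 + e)) (s-even (2 + k))) (2^-+ 2 (s (2 + k)))))
             (*-pres-∣ (∣-refl {+ 4}) (previous k λ m<k → rec (<-trans m<k k<n)))))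
    where
    k<n : k < suc k * 2
    k<n = s≤s (m≤n⇒m≤1+n (m≤m*n k 2))
  ... | suc k , inj₂ refl = subst₂ _∣ˢ_
    (sym (trans (cong (λ e → 2^ (2 + e)) (s-odd (2 + k))) (2^-+ 2 (1 + s (2 + k)))))
    (sym (V-odd (2 + k)))
    (*-pres-∣ (∣-refl {+ 4}) (∣-trans (2^-mono-∣ (n≤1+n (1 + s (2 + k))))
      (rec (s≤s (m≤n⇒m≤1+n (m≤n⇒m≤1+n (m≤m*n k 2)))))))

e : ℕ → ℤ
e n = 2^ (p n)

E-suc : ∀ n → E (suc n) ≡ + 2 *ᶻ e n
E-suc n = trans (cong 2^ (s≡suc-p n)) (2^-+ 1 (p n))

-- In `V (2 + n)` the two end terms add up to `4 e (suc n)` and the inner ones to `4 (e ⊛ e) n`. So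
-- four times the difference is `V (2 + n)` minus `8 e (suc n)`, and `V-divisible` makes both of
-- these multiples of `8 e (suc n)`.
e⊛e≡e : ∀ n → 2^ (suc (p (suc n))) ∣ˢ (e ⊛ e) n -ᶻ e (suc n)
e⊛e≡e n with V-divisible n
... | divides q V≡ = divides (q -ᶻ 1ℤ) (ℤ.*-cancelˡ-≡ (+ 4) _ _ (begin
  + 4 *ᶻ ((e ⊛ e) n -ᶻ e (suc n))
    ≡⟨ lemma₁ ((e ⊛ e) n) (e (suc n)) ⟩
  + 4 *ᶻ (e ⊛ e) n +ᶻ + 2 *ᶻ (+ 2 *ᶻ e (suc n)) -ᶻ + 8 *ᶻ e (suc n)
    ≡⟨ cong (_-ᶻ + 8 *ᶻ e (suc n)) V≡4e⊛e+2E ⟨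
  V (2 + n) -ᶻ + 8 *ᶻ e (suc n)
    ≡⟨ cong (_-ᶻ + 8 *ᶻ e (suc n)) (trans V≡ (cong (q *ᶻ_)
         (trans (cong (λ k → 2^ (2 + k)) (s≡suc-p (suc n))) (2^-+ 3 (p (suc n)))))) ⟩
  q *ᶻ (+ 8 *ᶻ e (suc n)) -ᶻ + 8 *ᶻ e (suc n)
    ≡⟨ lemma₂ q (e (suc n)) ⟩
  + 4 *ᶻ ((q -ᶻ 1ℤ) *ᶻ (+ 2 *ᶻ e (suc n)))
    ≡⟨ cong (λ k → + 4 *ᶻ ((q -ᶻ 1ℤ) *ᶻ k)) (2^-+ 1 (p (suc n))) ⟨
  + 4 *ᶻ ((q -ᶻ 1ℤ) *ᶻ 2^ (suc (p (suc n)))) ∎))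
  where
  open ≡-Reasoning
  lemma₁ : ∀ a b → + 4 *ᶻ (a -ᶻ b) ≡ + 4 *ᶻ a +ᶻ + 2 *ᶻ (+ 2 *ᶻ b) -ᶻ + 8 *ᶻ b
  lemma₁ = solve-∀
  lemma₂ : ∀ q b → q *ᶻ (+ 8 *ᶻ b) -ᶻ + 8 *ᶻ b ≡ + 4 *ᶻ ((q -ᶻ 1ℤ) *ᶻ (+ 2 *ᶻ b))
  lemma₂ = solve-∀
  lemma₃ : ∀ a b → 1ℤ *ᶻ a +ᶻ (b +ᶻ a *ᶻ 1ℤ) ≡ b +ᶻ + 2 *ᶻ a
  lemma₃ = solve-∀
  lemma₄ : ∀ a b → + 2 *ᶻ a *ᶻ (+ 2 *ᶻ b) ≡ + 4 *ᶻ (a *ᶻ b)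
  lemma₄ = solve-∀
  V≡4e⊛e+2E : V (2 + n) ≡ + 4 *ᶻ (e ⊛ e) n +ᶻ + 2 *ᶻ (+ 2 *ᶻ e (suc n))
  V≡4e⊛e+2E = begin
    1ℤ *ᶻ E (2 + n) +ᶻ conv (λ i j → E (suc i) *ᶻ E j) (suc n)
      ≡⟨ cong (1ℤ *ᶻ E (2 + n) +ᶻ_) (conv-last n λ i j → E (suc i) *ᶻ E j) ⟩
    1ℤ *ᶻ E (2 + n) +ᶻ (conv (λ i j → E (suc i) *ᶻ E (suc j)) n +ᶻ E (2 + n) *ᶻ 1ℤ)
      ≡⟨ lemma₃ (E (2 + n)) (conv (λ i j → E (suc i) *ᶻ E (suc j)) n) ⟩
    conv (λ i j → E (suc i) *ᶻ E (suc j)) n +ᶻ + 2 *ᶻ E (2 + n)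
      ≡⟨ cong₂ (λ a b → a +ᶻ + 2 *ᶻ b)
           (trans (conv-cong n λ i j _ → trans (cong₂ _*ᶻ_ (E-suc i) (E-suc j)) (lemma₄ (e i) (e j)))
                  (conv-*ˡ n (+ 4) _))
           (E-suc (suc n)) ⟩
    + 4 *ᶻ (e ⊛ e) n +ᶻ + 2 *ᶻ (+ 2 *ᶻ e (suc n)) ∎

-- Divisibility of iterated differences

-- 2^(k + i) ∣ Δ^i f for all i < m, in a form that suits induction on m.
SmallUpTo : ℕ → ℕ → (ℕ → ℤ) → Set
SmallUpTo zero    k f = ⊤
SmallUpTo (suc m) k f = (∀ x → 2^ k ∣ˢ f x) × SmallUpTo m (suc k) (Δ f)

Small : ℕ → (ℕ → ℤ) → Set
Small k f = ∀ m → SmallUpTo m k f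

small-∣ : ∀ {k f} → Small k f → ∀ x → 2^ k ∣ˢ f x
small-∣ small-f = proj₁ (small-f 1)

small-Δ : ∀ {k f} → Small k f → Small (suc k) (Δ f)
small-Δ small-f m = proj₂ (small-f (suc m))

smallUpTo-cong : ∀ m {k f g} → (∀ x → f x ≡ g x) → SmallUpTo m k f → SmallUpTo m k g
smallUpTo-cong zero    f≗g _                  = tt
smallUpTo-cong (suc m) f≗g (div-f , small-Δf) =
  (λ x → subst (_ ∣ˢ_) (f≗g x) (div-f x)) ,
  smallUpTo-cong m (λ x → cong₂ _-ᶻ_ (f≗g (suc x)) (f≗g x)) small-Δf

small-cong : ∀ {k f g} → (∀ x → f x ≡ g x) → Small k f → Small k g
small-cong f≗g small-f m = smallUpTo-cong m f≗g (small-f m)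

small-≤ : ∀ {j k f} → j ≤ k → Small k f → Small j f
small-≤ j≤k small-f zero    = tt
small-≤ j≤k small-f (suc m) =
  (λ x → ∣-trans (2^-mono-∣ j≤k) (small-∣ small-f x)) ,
  small-≤ (s≤s j≤k) (small-Δ small-f) m

small-shift : ∀ {k f} → Small k f → Small k (f ∘ suc)
small-shift small-f zero    = tt
small-shift small-f (suc m) = (λ x → small-∣ small-f (suc x)) , small-shift (small-Δ small-f) m

small-const : ∀ {k c} → 2^ k ∣ˢ c → Small k (λ _ → c)
small-const         2^k∣c zero    = tt
small-const {k} {c} 2^k∣c (suc m) = (λ _ → 2^k∣c) ,
  smallUpTo-cong m (λ _ → sym (ℤ.+-inverseʳ c)) (small-const {suc k} (divides 0ℤ refl) m)

smallUpTo-+ : ∀ m {k f g} → SmallUpTo m k f → SmallUpTo m k g → SmallUpTo m k (λ x → f x +ᶻ g x)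
smallUpTo-+ zero                _                  _                  = tt
smallUpTo-+ (suc m) {f = f} {g} (div-f , small-Δf) (div-g , small-Δg) =
  (λ x → ∣m∣n⇒∣m+n (div-f x) (div-g x)) ,
  smallUpTo-cong m (λ x → lemma (f (suc x)) (f x) (g (suc x)) (g x)) (smallUpTo-+ m small-Δf small-Δg)
  where
  lemma : ∀ a b c d → a -ᶻ b +ᶻ (c -ᶻ d) ≡ a +ᶻ c -ᶻ (b +ᶻ d)
  lemma = solve-∀

small-+ : ∀ {k f g} → Small k f → Small k g → Small k (λ x → f x +ᶻ g x)
small-+ small-f small-g m = smallUpTo-+ m (small-f m) (small-g m)

-- By the Leibniz rule Δ(fg)(x) = f(x+1) Δg(x) + Δf(x) g(x).
small-* : ∀ {j k f g} → Small j f → Small k g → Small (j + k) (λ x → f x *ᶻ g x)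
small-* small-f small-g zero = tt
small-* {j} {k} {f} {g} small-f small-g (suc m) =
  (λ x → subst (_∣ˢ _) (sym (2^-+ j k)) (*-pres-∣ (small-∣ small-f x) (small-∣ small-g x))) ,
  smallUpTo-cong m (λ x → lemma (f (suc x)) (f x) (g (suc x)) (g x))
    (smallUpTo-+ m
      (subst (λ i → SmallUpTo m i (λ x → f (suc x) *ᶻ Δ g x)) (+-suc j k)
             (small-* (small-shift small-f) (small-Δ small-g) m))
      (small-* (small-Δ small-f) small-g m))
  where
  lemma : ∀ a b c d → a *ᶻ (c -ᶻ d) +ᶻ (a -ᶻ b) *ᶻ d ≡ a *ᶻ c -ᶻ b *ᶻ d
  lemma = solve-∀

-- `Δ^` adds each new difference on the outside, whereas `SmallUpTo` takes it on the inside.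
Δ^-Δ : ∀ i f → Δ^ i (Δ f) ≡ Δ^ (suc i) f
Δ^-Δ zero    f = refl
Δ^-Δ (suc i) f = cong Δ (Δ^-Δ i f)

small-intro : ∀ {k f} → (∀ m x → 2^ (m + k) ∣ˢ Δ^ m f x) → Small k f
small-intro         div zero    = tt
small-intro {k} {f} div (suc m) = div 0 , small-intro
  (λ i x → subst₂ (λ j h → 2^ j ∣ˢ h x) (sym (+-suc i k)) (sym (Δ^-Δ i f)) (div (suc i) x)) m

-- In other words f = 2^k u, where u satisfies the two assumptions on b.
record Near (k : ℕ) (f : ℕ → ℤ) : Set where
  constructor near
  field small-error : Small (suc k) (λ x → f x -ᶻ 2^ k)

near-cong : ∀ {k f g} → (∀ x → f x ≡ g x) → Near k f → Near k g
near-cong {k} f≗g (near small-f) = near (small-cong (λ x → cong (_-ᶻ 2^ k) (f≗g x)) small-f)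

near-shift : ∀ {k f} → Near k f → Near k (f ∘ suc)
near-shift (near small-f) = near (small-shift small-f)

small-2^* : ∀ {k f} j → Small k f → Small (j + k) (λ x → 2^ j *ᶻ f x)
small-2^* j = small-* (small-const ∣-refl)

-- With f = 2^j + δ and g = 2^k + ε, the error of the product is δε + 2^j ε + 2^k δ.
near-* : ∀ {j k f g} → Near j f → Near k g → Near (j + k) (λ x → f x *ᶻ g x)
near-* {j} {k} {f} {g} (near small-f) (near small-g) = near (small-cong
  (λ x → trans (lemma (f x) (g x) (2^ j) (2^ k)) (cong (f x *ᶻ g x -ᶻ_) (sym (2^-+ j k))))
  (small-+ (small-≤ (s≤s (+-monoʳ-≤ j (n≤1+n k))) (small-* small-f small-g))
    (small-+ (subst (λ i → Small i (λ x → 2^ j *ᶻ (g x -ᶻ 2^ k))) (+-suc j k) (small-2^* j small-g))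
             (subst (λ i → Small i (λ x → 2^ k *ᶻ (f x -ᶻ 2^ j))) (trans (+-suc k j) (cong suc (+-comm k j)))
                    (small-2^* k small-f)))))
  where
  lemma : ∀ f g a b → (f -ᶻ a) *ᶻ (g -ᶻ b) +ᶻ (a *ᶻ (g -ᶻ b) +ᶻ b *ᶻ (f -ᶻ a)) ≡ f *ᶻ g -ᶻ a *ᶻ b
  lemma = solve-∀

-- Symmetrising gains a factor 2, since φ(x+1) + φ(x) = 2φ(x) + Δφ(x).
near-symmetrised : ∀ {j k f g} → Near j f → Near k g →
  Small (2 + (j + k)) (λ x → f (suc x) *ᶻ g x -ᶻ 2^ j *ᶻ 2^ k +ᶻ (g (suc x) *ᶻ f x -ᶻ 2^ k *ᶻ 2^ j))
near-symmetrised {j} {k} {f} {g} (near small-f) (near small-g) = small-cong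
  (λ x → lemma (f (suc x)) (f x) (g (suc x)) (g x) (2^ j) (2^ k))
  (small-+
    (small-+ (subst (λ i → Small i (λ x → 2^ j *ᶻ double g (2^ k) x)) (j+2+k≡2+j+k j k)
                    (small-2^* j (small-double g small-g)))
             (subst (λ i → Small i (λ x → 2^ k *ᶻ double f (2^ j) x)) (trans (j+2+k≡2+j+k k j) (cong (λ k → 2 + k) (+-comm k j)))
                    (small-2^* k (small-double f small-f))))
    -- Products of two errors are small enough as they stand; only the terms linear in the errors
    -- need the symmetrisation.
    (small-+ (subst (λ i → Small i (λ x → (f (suc x) -ᶻ 2^ j) *ᶻ (g x -ᶻ 2^ k))) (cong suc (+-suc j k))
                    (small-* (small-shift small-f) small-g))
             (subst (λ i → Small i (λ x → (f x -ᶻ 2^ j) *ᶻ (g (suc x) -ᶻ 2^ k))) (cong suc (+-suc j k))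
                    (small-* small-f (small-shift small-g)))))
  where
  double : (ℕ → ℤ) → ℤ → ℕ → ℤ
  double h c x = 2^ 1 *ᶻ (h x -ᶻ c) +ᶻ Δ (λ y → h y -ᶻ c) x
  small-double : ∀ {i} h → Small (suc i) (λ x → h x -ᶻ 2^ i) → Small (2 + i) (double h (2^ i))
  small-double h small-h = small-+ (small-2^* 1 small-h) (small-Δ small-h)
  j+2+k≡2+j+k : ∀ j k → j + (2 + k) ≡ 2 + (j + k)
  j+2+k≡2+j+k j k = trans (+-suc j (suc k)) (cong suc (+-suc j k))
  lemma : ∀ f′ f g′ g a b →
    a *ᶻ (+ 2 *ᶻ (g -ᶻ b) +ᶻ ((g′ -ᶻ b) -ᶻ (g -ᶻ b))) +ᶻ b *ᶻ (+ 2 *ᶻ (f -ᶻ a) +ᶻ ((f′ -ᶻ a) -ᶻ (f -ᶻ a))) +ᶻ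
      ((f′ -ᶻ a) *ᶻ (g -ᶻ b) +ᶻ (f -ᶻ a) *ᶻ (g′ -ᶻ b)) ≡
    f′ *ᶻ g -ᶻ a *ᶻ b +ᶻ (g′ *ᶻ f -ᶻ b *ᶻ a)
  lemma = solve-∀

-- The terms (i, j) and (j, i) are paired from the two ends inwards; for even n the middle term
-- remains alone.
small-conv : ∀ {k} n (g : ℕ → ℕ → ℕ → ℤ) →
  (∀ i j → i + j ≡ n → Small k (λ x → g i j x +ᶻ g j i x)) →
  (∀ i → i + i ≡ n → Small k (g i i)) →
  Small k (λ x → conv (λ i j → g i j x) n)
small-conv zero          g pair diag = diag 0 refl
small-conv (suc zero)    g pair diag = pair 0 1 refl
small-conv (suc (suc n)) g pair diag = small-cong
  (λ x → trans (lemma (g 0 (2 + n) x) (g (2 + n) 0 x) _)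
    (cong (g 0 (2 + n) x +ᶻ_) (sym (conv-last n λ i j → g (suc i) j x))))
  (small-+ (pair 0 (2 + n) refl)
           (small-conv n (λ i j → g (suc i) (suc j))
              (λ i j eq → pair (suc i) (suc j) (cong suc (trans (+-suc i j) (cong suc eq))))
              (λ i eq → diag (suc i) (cong suc (trans (+-suc i i) (cong suc eq))))))
  where
  lemma : ∀ a b c → a +ᶻ b +ᶻ c ≡ a +ᶻ (c +ᶻ b)
  lemma = solve-∀

-- Decomposition of Dyck paths

-- K b h n is the weight of the paths from height h to height 0 with n up steps.
K : (ℕ → ℤ) → ℕ → ℕ → ℤ
K b zero    zero    = 1ℤ
K b zero    (suc n) = b 0 *ᶻ K b 1 n
K b (suc h) zero    = K b h zero
K b (suc h) (suc n) = b (suc h) *ᶻ K b (2 + h) n +ᶻ K b h (suc n)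

sumℤ : List ℤ → ℤ
sumℤ = foldr _+ᶻ_ (+ 0)

sumℤ-++ : ∀ xs ys → sumℤ (xs ++ ys) ≡ sumℤ xs +ᶻ sumℤ ys
sumℤ-++ []       ys = sym (ℤ.+-identityˡ _)
sumℤ-++ (x ∷ xs) ys = trans (cong (x +ᶻ_) (sumℤ-++ xs ys)) (sym (ℤ.+-assoc x _ _))

module _ (b : ℕ → ℤ) where

  pathSum : ℕ → ℕ → ℤ
  pathSum h l = sumℤ (map (wt b) (paths h l))

  pathSum-up : ∀ h {l} (qs : List (Path (suc h) l)) →
               sumℤ (map (wt b) (map up qs)) ≡ b h *ᶻ sumℤ (map (wt b) qs)
  pathSum-up h []       = sym (ℤ.*-zeroʳ (b h))
  pathSum-up h (q ∷ qs) = trans (cong (b h *ᶻ wt b q +ᶻ_) (pathSum-up h qs))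
                                (sym (ℤ.*-distribˡ-+ (b h) _ _))

  pathSum-down : ∀ {h l} (qs : List (Path h l)) →
                 sumℤ (map (wt b) (map down qs)) ≡ sumℤ (map (wt b) qs)
  pathSum-down []       = refl
  pathSum-down (q ∷ qs) = cong (wt b q +ᶻ_) (pathSum-down qs)

  pathSum-suc : ∀ h l → pathSum (suc h) (suc l) ≡ b (suc h) *ᶻ pathSum (2 + h) l +ᶻ pathSum h l
  pathSum-suc h l = trans (cong sumℤ (map-++ (wt b) (map up (paths (2 + h) l)) _))
    (trans (sumℤ-++ (map (wt b) (map up (paths (2 + h) l))) _)
           (cong₂ _+ᶻ_ (pathSum-up (suc h) (paths (2 + h) l)) (pathSum-down (paths h l))))

  -- A step descends by at most 1, so no path exists. This removes the branch through `up` once no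
  -- up steps are left.
  pathSum≡0 : ∀ h l → l < h → pathSum h l ≡ 0ℤ
  pathSum≡0 (suc h) zero    _         = refl
  pathSum≡0 (suc h) (suc l) (s≤s l<h) = trans (pathSum-suc h l)
    (cong₂ _+ᶻ_ (trans (cong (b (suc h) *ᶻ_) (pathSum≡0 (2 + h) l (m≤n⇒m≤1+n (m≤n⇒m≤1+n l<h))))
                       (ℤ.*-zeroʳ (b (suc h))))
                (pathSum≡0 h l l<h))

  -- From height h, n up steps require h + n down steps.
  pathSum≡K : ∀ l h n → l ≡ h + 2 * n → pathSum h l ≡ K b h n
  pathSum≡K zero    zero    zero    eq = refl
  pathSum≡K (suc l) zero    (suc n) eq = trans (pathSum-up 0 (paths 1 l))
    (cong (b 0 *ᶻ_) (pathSum≡K l 1 n (trans (suc-injective eq) (+-suc n (n + 0)))))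
  pathSum≡K (suc l) (suc h) zero    eq = trans (pathSum-suc h l)
    (trans (cong₂ _+ᶻ_ (trans (cong (b (suc h) *ᶻ_) (pathSum≡0 (2 + h) l l<2+h)) (ℤ.*-zeroʳ (b (suc h))))
                       (pathSum≡K l h zero (suc-injective eq)))
           (ℤ.+-identityˡ _))
    where
    l<2+h : l < 2 + h
    l<2+h = s≤s (m≤n⇒m≤1+n (≤-reflexive (trans (suc-injective eq) (+-identityʳ h))))
  pathSum≡K (suc l) (suc h) (suc n) eq = trans (pathSum-suc h l)
    (cong₂ _+ᶻ_ (cong (b (suc h) *ᶻ_) (pathSum≡K l (2 + h) n (trans (suc-injective eq) (lemma h n))))
                (pathSum≡K l h (suc n) (suc-injective eq)))
    where
    lemma : ∀ h n → h + 2 * suc n ≡ 2 + h + 2 * n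
    lemma h n = trans (cong (λ k → h + k) (*-suc 2 n)) (trans (+-suc h _) (cong suc (+-suc h (2 * n))))

weightedCatalan≡K : ∀ b n → weightedCatalan b n ≡ K b 0 n
weightedCatalan≡K b n = pathSum≡K b (2 * n) 0 n refl

-- Recursive, so that `shift (suc h) b` and `shift 1 (shift h b)` are the same by definition;
-- `first-passage` and `F-suc` use this.
shift : ℕ → (ℕ → ℤ) → ℕ → ℤ
shift zero    b = b
shift (suc h) b = shift h b ∘ suc

shift≡ : ∀ h b x → shift h b x ≡ b (h + x)
shift≡ zero    b x = refl
shift≡ (suc h) b x = trans (shift≡ h b (suc x)) (cong b (+-suc h x))

shift-0 : ∀ h b → shift h b 0 ≡ b h
shift-0 h b = trans (shift≡ h b 0) (cong b (+-identityʳ h))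

-- A path from height h + 1 is cut at its first arrival at height h. Before the step that arrives
-- there it stays at height at least h + 1, hence is a Dyck path for the shifted weights. An initial
-- down step gives the term i = 0; after an initial up step there are two successive passages,
-- regrouped by associativity.
first-passage : ∀ n h b → K b (suc h) n ≡ (K (shift (suc h) b) 0 ⊛ K b h) n
first-passage = <-rec _ step
  where
  step : ∀ n → (∀ {m} → m < n → ∀ h b → K b (suc h) m ≡ (K (shift (suc h) b) 0 ⊛ K b h) m) →
         ∀ h b → K b (suc h) n ≡ (K (shift (suc h) b) 0 ⊛ K b h) n
  step zero    rec h b = sym (ℤ.*-identityˡ (K b h 0))
  step (suc n) rec h b = trans (ℤ.+-comm _ (K b h (suc n)))
    (cong₂ _+ᶻ_ (sym (ℤ.*-identityˡ (K b h (suc n)))) (begin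
      b (suc h) *ᶻ K b (2 + h) n
        ≡⟨ cong₂ _*ᶻ_ (sym (shift-0 (suc h) b)) (rec ≤-refl (suc h) b) ⟩
      c 0 *ᶻ (K (c ∘ suc) 0 ⊛ K b (suc h)) n
        ≡⟨ cong (c 0 *ᶻ_) (conv-cong n λ i j i+j≡n → cong (K (c ∘ suc) 0 i *ᶻ_)
             (rec (s≤s (m+n≤o⇒n≤o i (≤-reflexive i+j≡n))) h b)) ⟩
      c 0 *ᶻ (K (c ∘ suc) 0 ⊛ (K c 0 ⊛ K b h)) n
        ≡⟨ cong (c 0 *ᶻ_) (⊛-assoc n (K (c ∘ suc) 0) (K c 0) (K b h)) ⟨
      c 0 *ᶻ (K (c ∘ suc) 0 ⊛ K c 0 ⊛ K b h) n
        -- The induction hypothesis for `c`, read backwards, merges the first two factors into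
        -- `K c 1`; its product with `c 0` is `K c 0 (suc i)` by definition.
        ≡⟨ cong (c 0 *ᶻ_) (conv-cong n λ i j i+j≡n → cong (_*ᶻ K b h j)
             (sym (rec (s≤s (m+n≤o⇒m≤o i (≤-reflexive i+j≡n))) 0 c))) ⟩
      c 0 *ᶻ (K c 1 ⊛ K b h) n
        ≡⟨ conv-*ˡ n (c 0) (λ i j → K c 1 i *ᶻ K b h j) ⟨
      conv (λ i j → c 0 *ᶻ (K c 1 i *ᶻ K b h j)) n
        ≡⟨ conv-cong n (λ i j _ → sym (ℤ.*-assoc (c 0) (K c 1 i) (K b h j))) ⟩
      conv (λ i j → c 0 *ᶻ K c 1 i *ᶻ K b h j) n ∎))
    where
    open ≡-Reasoning
    c = shift (suc h) b

-- Weighted Catalan numbers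

module _ (b : ℕ → ℤ) where

  F : ℕ → ℕ → ℤ
  F n x = K (shift x b) 0 n

  F-suc : ∀ n x → F (suc n) x ≡ b x *ᶻ conv (λ i j → F i (suc x) *ᶻ F j x) n
  F-suc n x = cong₂ _*ᶻ_ (shift-0 x b) (first-passage n 0 (shift x b))

  near-F : Near 0 b → ∀ n → Near (p n) (F n)
  near-F near-b = <-rec _ step
    where
    step : ∀ n → (∀ {m} → m < n → Near (p m) (F m)) → Near (p n) (F n)
    step zero    rec = near (small-const (divides 0ℤ refl))
    step (suc n) rec = near-cong (λ x → sym (F-suc n x))
      -- The factor `b` has exponent 0. The error of the convolution splits into that of replacing
      -- each `F i` by the constant `e i` and that of replacing `(e ⊛ e) n` by `e (suc n)`.
      (near-* near-b (near (small-cong lemma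
        (small-+ (small-conv n g pair diag) (small-const (e⊛e≡e n))))))
      where
      g : ℕ → ℕ → ℕ → ℤ
      g i j x = F i (suc x) *ᶻ F j x -ᶻ e i *ᶻ e j
      lemma : ∀ x → conv (λ i j → g i j x) n +ᶻ ((e ⊛ e) n -ᶻ e (suc n)) ≡
                    conv (λ i j → F i (suc x) *ᶻ F j x) n -ᶻ e (suc n)
      lemma x = begin
        conv (λ i j → g i j x) n +ᶻ ((e ⊛ e) n -ᶻ e (suc n))
          ≡⟨ ℤ.+-assoc (conv (λ i j → g i j x) n) ((e ⊛ e) n) _ ⟨
        conv (λ i j → g i j x) n +ᶻ (e ⊛ e) n -ᶻ e (suc n)
          ≡⟨ cong (_-ᶻ e (suc n)) (conv-+ n (λ i j → g i j x) (λ i j → e i *ᶻ e j)) ⟨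
        conv (λ i j → g i j x +ᶻ e i *ᶻ e j) n -ᶻ e (suc n)
          ≡⟨ cong (_-ᶻ e (suc n)) (conv-cong n λ i j _ → lemma′ (F i (suc x) *ᶻ F j x) (e i *ᶻ e j)) ⟩
        conv (λ i j → F i (suc x) *ᶻ F j x) n -ᶻ e (suc n) ∎
        where
        open ≡-Reasoning
        lemma′ : ∀ a b → a -ᶻ b +ᶻ b ≡ a
        lemma′ = solve-∀
      recˡ : ∀ i j → i + j ≡ n → Near (p i) (F i)
      recˡ i j eq = rec (s≤s (m+n≤o⇒m≤o i (≤-reflexive eq)))
      recʳ : ∀ i j → i + j ≡ n → Near (p j) (F j)
      recʳ i j eq = rec (s≤s (m+n≤o⇒n≤o i (≤-reflexive eq)))
      pair : ∀ i j → i + j ≡ n → Small (suc (p (suc n))) (λ x → g i j x +ᶻ g j i x)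
      pair i j eq = small-≤
        (begin
          suc (p (suc n))         ≡⟨ s≡suc-p (suc n) ⟨
          s (2 + n)               ≡⟨ cong (λ k → s (2 + k)) eq ⟨
          s (2 + (i + j))         ≡⟨ cong (λ k → s (suc k)) (+-suc i j) ⟨
          s (suc i + suc j)       ≤⟨ s-subadditive (suc i) (suc j) ⟩
          s (suc i) + s (suc j)   ≡⟨ cong₂ _+_ (s≡suc-p i) (s≡suc-p j) ⟩
          suc (p i) + suc (p j)   ≡⟨ cong suc (+-suc (p i) (p j)) ⟩
          2 + (p i + p j)         ∎)
        (near-symmetrised (recˡ i j eq) (recʳ i j eq))
        where open ≤-Reasoning
      -- The middle term has no partner to gain a factor 2 from, and needs none: n + 2 = 2(i + 1)
      -- gives p(n + 1) = p(i), which is at most 2p(i).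
      diag : ∀ i → i + i ≡ n → Small (suc (p (suc n))) (g i i)
      diag i eq = small-cong (λ x → cong (F i (suc x) *ᶻ F i x -ᶻ_) (2^-+ (p i) (p i)))
        (small-≤ (s≤s (≤-trans (≤-reflexive p[1+n]≡p[i]) (m≤m+n (p i) (p i))))
          (Near.small-error (near-* (near-shift (recˡ i i eq)) (recˡ i i eq))))
        where
        p[1+n]≡p[i] : p (suc n) ≡ p i
        p[1+n]≡p[i] = cong (_∸ 1) (trans (cong (λ k → s (2 + k)) (trans (sym eq) (sym (trans (*-comm i 2) (cong (λ k → i + k) (+-identityʳ i))))))
                                 (s-even (suc i)))

  near-weightedCatalan : Near 0 b → ∀ n → 2^ (suc (p n)) ∣ˢ weightedCatalan b n -ᶻ e n
  near-weightedCatalan near-b n = subst (λ c → 2^ (suc (p n)) ∣ˢ c -ᶻ e n) (sym (weightedCatalan≡K b n))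
    (small-∣ (Near.small-error (near-F near-b n)) 0)

-- Hypotheses on `b` and the valuation `ξ`

¬2∣⇒2∣-1 : ∀ z → ¬ (+ 2 ∣ˢ z) → + 2 ∣ˢ z -ᶻ 1ℤ
¬2∣⇒2∣-1 z ¬2∣z with z %ᶻ + 2 | a≡a%n+[a/n]*n z (+ 2) | n%d<d z (+ 2)
... | 0           | eq | _ = contradiction (divides (z /ᶻ + 2) (trans eq (ℤ.+-identityˡ _))) ¬2∣z
... | 1           | eq | _ = divides (z /ᶻ + 2) (trans (cong (_-ᶻ 1ℤ) eq) (lemma (z /ᶻ + 2)))
  where
  lemma : ∀ q → 1ℤ +ᶻ q *ᶻ + 2 -ᶻ 1ℤ ≡ q *ᶻ + 2
  lemma = solve-∀
... | suc (suc _) | _  | s≤s (s≤s ())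

-- Oddness spreads from `b 0` to every `b x` because the first differences are even. Subtracting the
-- constant 1 leaves all differences unchanged.
near-hypothesis : (b : ℕ → ℤ) → ¬ (+ 2 ∣ b 0) →
  (∀ m → 1 ≤ m → ∀ x → + (2 ^ (m + 1)) ∣ Δ^ m b x) → Near 0 b
near-hypothesis b b0-odd div = near λ where
    zero    → tt
    (suc m) → 2∣b-1 , smallUpTo-cong m (λ x → lemma (b (suc x)) (b x)) (small-Δb m)
  where
  lemma : ∀ a c → a -ᶻ c ≡ a -ᶻ 1ℤ -ᶻ (c -ᶻ 1ℤ)
  lemma = solve-∀
  small-Δb : Small 2 (Δ b)
  small-Δb = small-intro λ i x → subst₂ (λ j h → 2^ j ∣ˢ h x)
    (sym (+-suc i 1)) (sym (Δ^-Δ i b)) (∣ᵤ⇒∣ (div (suc i) (s≤s z≤n) x))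
  2∣b-1 : ∀ x → + 2 ∣ˢ b x -ᶻ 1ℤ
  2∣b-1 zero    = ¬2∣⇒2∣-1 (b 0) (b0-odd ∘ ∣⇒∣ᵤ)
  2∣b-1 (suc x) = subst (+ 2 ∣ˢ_) (lemma′ (b (suc x)) (b x))
    (∣m∣n⇒∣m+n (∣-trans (2^-mono-∣ {1} {2} (s≤s z≤n)) (small-∣ small-Δb x)) (2∣b-1 x))
    where
    lemma′ : ∀ a c → a -ᶻ c +ᶻ (c -ᶻ 1ℤ) ≡ a -ᶻ 1ℤ
    lemma′ = solve-∀

-- If 2^j with j > k divided z, then 2^(k+1) would divide both z and z - 2^k, hence 2^k, which is
-- too small.
ξ-intro : ∀ z k → 2^ (suc k) ∣ˢ z -ᶻ 2^ k → ξ⟨ z ⟩≡ k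
ξ-intro z k div = ∣⇒∣ᵤ 2^k∣z , maximal
  where
  lemma : ∀ a b → a -ᶻ b +ᶻ b ≡ a
  lemma = solve-∀
  lemma′ : ∀ a b → a -ᶻ (a -ᶻ b) ≡ b
  lemma′ = solve-∀
  2^k∣z : 2^ k ∣ˢ z
  2^k∣z = subst (2^ k ∣ˢ_) (lemma z (2^ k)) (∣m∣n⇒∣m+n (∣-trans (2^-mono-∣ (n≤1+n k)) div) ∣-refl)
  maximal : ∀ j → 2^ j ∣ z → j ≤ k
  maximal j 2^j∣z = ≮⇒≥ λ k<j → <⇒≱ (^-monoʳ-< 2 ≤-refl (n<1+n k))
    (∣⇒≤ {{m^n≢0 2 k}} (∣⇒∣ᵤ (subst (2^ (suc k) ∣ˢ_) (lemma′ z (2^ k))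
      (∣m∣n⇒∣m-n (∣-trans (2^-mono-∣ k<j) (∣ᵤ⇒∣ {i = z} 2^j∣z)) div))))

ξ-2^*odd : ∀ k {q} → Odd q → ξ⟨ + (2 ^ k * q) ⟩≡ k
ξ-2^*odd k (j , refl) = ξ-intro (+ (2 ^ k * (1 + j * 2))) k (divides (+ j) (begin
  + (2 ^ k * (1 + j * 2)) -ᶻ 2^ k    ≡⟨ cong (_-ᶻ 2^ k) (ℤ.pos-* (2 ^ k) (1 + j * 2)) ⟩
  2^ k *ᶻ + (1 + j * 2) -ᶻ 2^ k      ≡⟨ cong (λ i → 2^ k *ᶻ (1ℤ +ᶻ i) -ᶻ 2^ k) (ℤ.pos-* j 2) ⟩
  2^ k *ᶻ (1ℤ +ᶻ + j *ᶻ + 2) -ᶻ 2^ k ≡⟨ lemma (2^ k) (+ j) ⟩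
  + j *ᶻ (+ 2 *ᶻ 2^ k)               ≡⟨ cong (+ j *ᶻ_) (2^-+ 1 k) ⟨
  + j *ᶻ 2^ (suc k)                  ∎))
  where
  open ≡-Reasoning
  lemma : ∀ a j → a *ᶻ (1ℤ +ᶻ j *ᶻ + 2) -ᶻ a ≡ j *ᶻ (+ 2 *ᶻ a)
  lemma = solve-∀

ξ-catalan : ∀ n → ξ⟨ + catalan n ⟩≡ p n
ξ-catalan n = let q , odd-q , eq = catalan-2adic n in
  subst (λ c → ξ⟨ + c ⟩≡ p n) (sym eq) (ξ-2^*odd (p n) odd-q)

theorem2p1 : (b : ℕ → ℤ) →
    ¬ (+ 2 ∣ b 0) →
    (∀ m → 1 ≤ m → ∀ x → + (2 ^ (m + 1)) ∣ Δ^ m b x) →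
    ∀ n →
    (ξ⟨ weightedCatalan b n ⟩≡ (s (n + 1) ∸ 1)) ×
    (ξ⟨ + catalan n ⟩≡ (s (n + 1) ∸ 1))
theorem2p1 b b0-odd div n = subst
  (λ k → (ξ⟨ weightedCatalan b n ⟩≡ (s k ∸ 1)) × (ξ⟨ + catalan n ⟩≡ (s k ∸ 1)))
  (+-comm 1 n)
  (ξ-intro (weightedCatalan b n) (p n) (near-weightedCatalan b (near-hypothesis b b0-odd div) n) , ξ-catalan n)
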